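{- There exist absolute constants $C, c > 0$ and $n_0$ such that for every integer $n \ge n_0$ that is a power of $2$, there is a Boolean function $f:\{0,1\}^{2n}\to\{0,1\}$ satisfying: (1) $\mathrm{Inf}^{ - }_i[f] = 0$ for all $i \in \{1,\dots,n\}$; (2) $\mathrm{Inf}^{ - }_i[f] \le C/n$ for all $i \in \{n+1,\dots,2n\}$; (3) $\varepsilon(f) \ge c$. In particular, there is no absolute constant $c'>0$ such that every $f:\{0,1\}^m\to\{0,1\}$ has a coordinate $i\in[m]$ with $\mathrm{Inf}^{ - }_i[f] \ge c'\,\varepsilon(f)\cdot \frac{\log m}{m}$.
   Context: For $x,y\in\{0,1\}^m$, write $x\preccurlyeq y$ if $x_i\le y_i$ for all $i\in[m]$. A function $g:\{0,1\}^m\to\{0,1\}$ is monotone if $x\preccurlyeq y$ implies $g(x)\le g(y)$. For $x\in\{0,1\}^m$ and $i\in[m]$, $x^{\oplus i}$ denotes $x$ with the $i$-th coordinate flipped. For $f:\{0,1\}^m\to\{0,1\}$, the negative influence of coordinate $i$ is $\mathrm{Inf}^{ - }_i[f] := \frac{1}{2^{m-1}}\#\{x\in\{0,1\}^m : f(x) > f(x^{\oplus i}) \text{ and } x\preccurlyeq x^{\oplus i}\}$. The distance to monotonicity is $\varepsilon(f) := \min_{g \text{ monotone}} \Pr_{\mathbf{x}\sim\{0,1\}^m}[f(\mathbf{x})\ne g(\mathbf{x})]$, where $\mathbf{x}$ is uniform. -}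

module Defs where

open import Data.Bool.Base as Bool using (Bool; true; false; not)
open import Data.Bool.Properties using (_≟_; _≤?_; _<?_)
open import Data.Fin.Base using (Fin)
open import Data.Fin.Properties using (all?)
open import Data.Integer.Base using (+_)
open import Data.List.Base
  using (List; []; _∷_; length; filter; cartesianProductWith)
import Data.List.Extrema as Extrema
open import Data.List.Membership.Propositional using (_∈_; lose)
open import Data.List.Membership.Propositional.Properties
  using (∈-cartesianProductWith⁺; ∈-filter⁺)
import Data.List.Relation.Unary.All as All
open import Data.List.Relation.Unary.All.Properties using (all-filter)
open import Data.List.Relation.Unary.Any using (here; there)
open import Data.Nat.Base as ℕ using (ℕ; zero; suc; _∸_; _^_; NonZero)
open import Data.Nat.Properties using (m^n≢0)
open import Data.Product.Base using (_×_; _,_; proj₁; proj₂; ∃-syntax)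
open import Data.Rational.Base as ℚ using (ℚ; _/_)
open import Data.Rational.Properties using (≤-decTotalOrder; ≤-reflexive)
open import Data.Sum.Base using (inj₂)
open import Data.Vec.Base using (Vec; []; _∷_; lookup; _[_]%=_)
open import Function.Base using (const; _∘_)
open import Level using (0ℓ)
open import Relation.Binary.Bundles using (module DecTotalOrder)
open import Relation.Binary.PropositionalEquality
  using (_≡_; _≗_; refl; cong; sym)
open import Relation.Nullary.Decidable
  using (Dec; map′; _→-dec_; _×-dec_; ¬?; does)
open import Relation.Unary using (Pred; Decidable)

Cube : ℕ → Set
Cube = Vec Bool

BoolFun : ℕ → Set
BoolFun m = Cube m → Bool

infix 4 _≼_ _≼?_

_≼_ : ∀ {m} → Cube m → Cube m → Set
x ≼ y = ∀ i → lookup x i Bool.≤ lookup y i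

_≼?_ : ∀ {m} (x y : Cube m) → Dec (x ≼ y)
x ≼? y = all? λ i → lookup x i ≤? lookup y i

infixl 8 _⊕_

_⊕_ : ∀ {m} → Cube m → Fin m → Cube m
x ⊕ i = x [ i ]%= not

Monotone : ∀ {m} → BoolFun m → Set
Monotone g = ∀ x y → x ≼ y → g x Bool.≤ g y

cube : ∀ m → List (Cube m)
cube zero    = [] ∷ []
cube (suc m) = cartesianProductWith _∷_ (false ∷ true ∷ []) (cube m)

# : ∀ {m} {P : Pred (Cube m) 0ℓ} → Decidable P → ℕ
# {m} P? = length (filter P? (cube m))

infixl 7 _/2^_

_/2^_ : ℕ → ℕ → ℚ
k /2^ m = _/_ (+ k) (2 ^ m) {{m^n≢0 2 m}}

-- Probability of P at a uniformly random point of the cube.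
Pr : ∀ {m} {P : Pred (Cube m) 0ℓ} → Decidable P → ℚ
Pr {m} P? = # P? /2^ m

NegEdge : ∀ {m} → BoolFun m → Fin m → Pred (Cube m) 0ℓ
NegEdge f i x = f (x ⊕ i) Bool.< f x × x ≼ x ⊕ i

negEdge? : ∀ {m} (f : BoolFun m) (i : Fin m) → Decidable (NegEdge f i)
negEdge? f i x = (f (x ⊕ i) <? f x) ×-dec (x ≼? x ⊕ i)

-- Truncated subtraction is harmless in the exponent: i : Fin m forces m ≥ 1.
Inf⁻ : ∀ {m} → Fin m → BoolFun m → ℚ
Inf⁻ {m} i f = # (negEdge? f i) /2^ (m ∸ 1)

dist : ∀ {m} → BoolFun m → BoolFun m → ℚ
dist f g = Pr λ x → ¬? (f x ≟ g x)

∈-bools : ∀ b → b ∈ false ∷ true ∷ []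
∈-bools false = here refl
∈-bools true  = there (here refl)

∈-cube : ∀ {m} (x : Cube m) → x ∈ cube m
∈-cube []      = here refl
∈-cube (b ∷ x) = ∈-cartesianProductWith⁺ _∷_ (∈-bools b) (∈-cube x)

∀-cube? : ∀ {m} {P : Pred (Cube m) 0ℓ} → Decidable P → Dec (∀ x → P x)
∀-cube? {m} P? = map′ (λ ps x → All.lookup ps (∈-cube x))
                      (λ p → All.universal p (cube m))
                      (All.all? P? (cube m))

monotone? : ∀ {m} → Decidable (Monotone {m})
monotone? g = ∀-cube? λ x → ∀-cube? λ y → (x ≼? y) →-dec (g x ≤? g y)

branch : ∀ {m} → BoolFun m → BoolFun m → BoolFun (suc m)
branch g₀ g₁ (false ∷ x) = g₀ x
branch g₀ g₁ (true  ∷ x) = g₁ x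

-- Every Boolean function on the cube occurs here up to pointwise equality
-- (see allFuns-complete).
allFuns : ∀ m → List (BoolFun m)
allFuns zero    = const false ∷ const true ∷ []
allFuns (suc m) = cartesianProductWith branch (allFuns m) (allFuns m)

open Extrema (DecTotalOrder.totalOrder ≤-decTotalOrder)
  using (argmin; argmin-all; f[argmin]≤v⁺)

-- A monotone function closest to f.  The starting value const false of the
-- search is itself monotone, so it does not affect the minimum.
nearestMonotone : ∀ {m} → BoolFun m → BoolFun m
nearestMonotone {m} f =
  argmin (dist f) (const false) (filter monotone? (allFuns m))

ε : ∀ {m} → BoolFun m → ℚ
ε f = dist f (nearestMonotone f)

-- a ·log₂ m ≤ b  says  a · log₂ m ≤ b  in the reals, for a ≥ 0 and m ≥ 1:
-- log₂ m is the supremum of the rationals p / r ≥ 0 with p / r ≤ log₂ m,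
-- that is, with 2 ^ p ≤ m ^ r.
infix 4 _·log₂_≤_

_·log₂_≤_ : ℚ → ℕ → ℚ → Set
a ·log₂ m ≤ b =
  ∀ p r .{{_ : NonZero r}} → 2 ^ p ℕ.≤ m ^ r → a ℚ.* (+ p / r) ℚ.≤ b

-- The next facts establish that ε f is the minimum of dist f g over all
-- monotone g.

allFuns-complete : ∀ {m} (g : BoolFun m) → ∃[ h ] h ∈ allFuns m × h ≗ g
allFuns-complete {zero} g with g [] in eq
... | false = const false , here refl , λ { [] → sym eq }
... | true  = const true , there (here refl) , λ { [] → sym eq }
allFuns-complete {suc m} g
  with h₀ , h₀∈ , h₀≗ ← allFuns-complete (g ∘ (false ∷_))
     | h₁ , h₁∈ , h₁≗ ← allFuns-complete (g ∘ (true ∷_))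
  = branch h₀ h₁
  , ∈-cartesianProductWith⁺ branch h₀∈ h₁∈
  , λ { (false ∷ x) → h₀≗ x ; (true ∷ x) → h₁≗ x }

Monotone-resp-≗ : ∀ {m} {g h : BoolFun m} → h ≗ g → Monotone g → Monotone h
Monotone-resp-≗ h≗g mono x y x≼y rewrite h≗g x | h≗g y = mono x y x≼y

dist-congʳ : ∀ {m} (f : BoolFun m) {g h : BoolFun m} → h ≗ g →
             dist f h ≡ dist f g
dist-congʳ {m} f {g} {h} h≗g = cong (_/2^ m) (go (cube m))
  where
  go : ∀ xs → length (filter (λ x → ¬? (f x ≟ h x)) xs)
            ≡ length (filter (λ x → ¬? (f x ≟ g x)) xs)
  go []       = refl
  go (x ∷ xs) rewrite h≗g x with does (¬? (f x ≟ g x))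
  ... | false = go xs
  ... | true  = cong suc (go xs)

nearestMonotone-monotone : ∀ {m} (f : BoolFun m) → Monotone (nearestMonotone f)
nearestMonotone-monotone {m} f =
  argmin-all (dist f) {P = Monotone} (λ _ _ _ → Bool.b≤b)
             (all-filter monotone? (allFuns m))

ε-minimal : ∀ {m} (f g : BoolFun m) → Monotone g → ε f ℚ.≤ dist f g
ε-minimal {m} f g mono =
  f[argmin]≤v⁺ {f = dist f} (const false) (filter monotone? (allFuns m))
    (inj₂ (lose {P = λ k → dist f k ℚ.≤ dist f g}
                (∈-filter⁺ monotone? h∈ (Monotone-resp-≗ h≗g mono))
                (≤-reflexive (dist-congʳ f h≗g))))
  where
  h∈  = proj₁ (proj₂ (allFuns-complete g))
  h≗g = proj₂ (proj₂ (allFuns-complete g))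

{-# OPTIONS --safe #-}
-- Let S be a monotone map from the cube of the first n variables x to the flat
-- lattice with levels 1, …, n between bot and top, and let f (x , y) be 0 if
-- S x = bot, 1 if S x = top, and ¬ y_j if S x is the level j.  Then f is monotone
-- in x, y_j has negative influence at most 2 Pr[S x = j], and flipping y_j at the
-- points with S x = j gives disjoint violated edges, so f is at distance at least
-- Pr[S x is a level] / 2 from monotone.  What is needed is thus an S with every
-- level of probability O(1/n) and with some level attained with constant
-- probability.
--
-- 2^a disjoint tribes of width a + 1, with S x the unique tribe that is all ones
-- (bot if there is none, top if there are several), attain a level with
-- probability at least 1/4, each level having probability at most 2^-(a+1), but
-- use (a + 1) 2^a variables.  The lexicographic product of two such maps with
-- 2^a · 2^b = n levels on disjoint variables has all the probabilities required
-- and, for a and b close to log n / 2, fits into n variables.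

module Submission where

open import Defs
open import Data.Bool.Base as Bool using (Bool; true; false; not; _∧_; if_then_else_)
import Data.Bool.Properties as Bool
open import Data.Empty using (⊥-elim)
open import Data.Fin.Base using (Fin; zero; suc; _↑ˡ_; _↑ʳ_; combine; splitAt)
import Data.Fin.Properties as Fin
open import Data.Integer.Base as ℤ using (1ℤ; +[1+_]; -[1+_])
import Data.Integer.Properties as ℤ
open import Data.List.Base as List using ([]; _∷_; length; filter)
import Data.List.Properties as List
import Data.List.Relation.Unary.All as All
open import Data.Nat.Base as ℕ using (ℕ; zero; suc; NonZero; z≤n; s≤s; _+_; _^_) renaming (_≤_ to _≤ℕ_)
import Data.Nat.Properties as ℕ
open import Data.Nat.Tactic.RingSolver using (solve-∀)
open import Data.Product.Base using (_×_; _,_; proj₁; proj₂; ∃-syntax; Σ-syntax)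
open import Data.Rational.Base as ℚ using (ℚ; 0ℚ; 1ℚ; mkℚ; toℚᵘ; _/_; _*_; _≤_; _<_)
import Data.Rational.Properties as ℚ
open import Data.Rational.Unnormalised.Base as ℚᵘ using (mkℚᵘ)
import Data.Rational.Unnormalised.Properties as ℚᵘ
open import Data.Sum.Base using (inj₁; inj₂)
open import Data.Vec.Base as Vec using ([]; _∷_; take; drop; lookup; _++_)
import Data.Vec.Properties as Vec
open import Function.Base using (_∘_)
open import Relation.Binary.PropositionalEquality using (_≡_; refl; sym; trans; cong; cong₂; subst; subst₂; module ≡-Reasoning)
open import Relation.Nullary.Decidable.Core using (Dec; yes; no; does; ¬?)
open import Relation.Nullary.Negation using (¬_)
open import Relation.Unary using (Pred; Decidable)

private variable
  m n v v′ J J′ p p′ u u′ : ℕ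

-- Sums over the cube

-- Recursion on the dimension turns splitting into blocks and flipping a coordinate into short
-- inductions; `#≡∑` carries the results over to the counts `#`.
∑ : ∀ m → (Cube m → ℕ) → ℕ
∑ zero    F = F []
∑ (suc m) F = ∑ m (λ x → F (false ∷ x)) + ∑ m (λ x → F (true ∷ x))

∑-cong : ∀ m {F G : Cube m → ℕ} → (∀ x → F x ≡ G x) → ∑ m F ≡ ∑ m G
∑-cong zero    e = e []
∑-cong (suc m) e = cong₂ _+_ (∑-cong m (e ∘ (false ∷_))) (∑-cong m (e ∘ (true ∷_)))

∑-mono : ∀ m {F G : Cube m → ℕ} → (∀ x → F x ≤ℕ G x) → ∑ m F ≤ℕ ∑ m G
∑-mono zero    e = e []
∑-mono (suc m) e = ℕ.+-mono-≤ (∑-mono m (e ∘ (false ∷_))) (∑-mono m (e ∘ (true ∷_)))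

∑-+ : ∀ m (F G : Cube m → ℕ) → ∑ m (λ x → F x + G x) ≡ ∑ m F + ∑ m G
∑-+ zero    F G = refl
∑-+ (suc m) F G
  rewrite ∑-+ m (F ∘ (false ∷_)) (G ∘ (false ∷_)) | ∑-+ m (F ∘ (true ∷_)) (G ∘ (true ∷_))
  = interchange (∑ m (F ∘ (false ∷_))) (∑ m (G ∘ (false ∷_))) _ _
  where
  interchange : ∀ a b c d → (a + b) + (c + d) ≡ (a + c) + (b + d)
  interchange = solve-∀

∑-*ʳ : ∀ m (F : Cube m → ℕ) c → ∑ m (λ x → F x ℕ.* c) ≡ ∑ m F ℕ.* c
∑-*ʳ zero    F c = refl
∑-*ʳ (suc m) F c
  rewrite ∑-*ʳ m (F ∘ (false ∷_)) c | ∑-*ʳ m (F ∘ (true ∷_)) c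
  = sym (ℕ.*-distribʳ-+ c (∑ m (F ∘ (false ∷_))) _)

∑-const : ∀ m c → ∑ m (λ _ → c) ≡ 2 ^ m ℕ.* c
∑-const zero    c = sym (ℕ.+-identityʳ c)
∑-const (suc m) c rewrite ∑-const m c = double (2 ^ m) c
  where
  double : ∀ a c → a ℕ.* c + a ℕ.* c ≡ 2 ℕ.* a ℕ.* c
  double = solve-∀

∑-1 : ∀ m → ∑ m (λ _ → 1) ≡ 2 ^ m
∑-1 m = trans (∑-const m 1) (ℕ.*-identityʳ _)

∑-++ : ∀ m {n} (F : Cube (m + n) → ℕ) →
       ∑ (m + n) F ≡ ∑ m (λ x → ∑ n (λ y → F (x ++ y)))
∑-++ zero    F = refl
∑-++ (suc m) F = cong₂ _+_ (∑-++ m (F ∘ (false ∷_))) (∑-++ m (F ∘ (true ∷_)))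

-- A flip permutes the cube; for the first coordinate it just swaps the two half sums.
∑-⊕ : ∀ m (F : Cube m → ℕ) (i : Fin m) → ∑ m (λ x → F (x ⊕ i)) ≡ ∑ m F
∑-⊕ (suc m) F zero    = ℕ.+-comm (∑ m (F ∘ (true ∷_))) _
∑-⊕ (suc m) F (suc i) = cong₂ _+_ (∑-⊕ m (F ∘ (false ∷_)) i) (∑-⊕ m (F ∘ (true ∷_)) i)

take-++ : (x : Cube m) (y : Cube n) → take m (x ++ y) ≡ x
take-++ {m} x y = Vec.++-injectiveˡ (take m (x ++ y)) x (Vec.take++drop≡id m (x ++ y))

drop-++ : (x : Cube m) (y : Cube n) → drop m (x ++ y) ≡ y
drop-++ {m} x y = Vec.++-injectiveʳ (take m (x ++ y)) x (Vec.take++drop≡id m (x ++ y))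

-- Independence of disjoint blocks of variables, the source of every product of probabilities below.
∑-* : ∀ m {n} (F : Cube m → ℕ) (G : Cube n → ℕ) →
      ∑ (m + n) (λ z → F (take m z) ℕ.* G (drop m z)) ≡ ∑ m F ℕ.* ∑ n G
∑-* m {n} F G = begin
  ∑ (m + n) (λ z → F (take m z) ℕ.* G (drop m z))
    ≡⟨ ∑-++ m _ ⟩
  ∑ m (λ x → ∑ n (λ y → F (take m (x ++ y)) ℕ.* G (drop m (x ++ y))))
    ≡⟨ ∑-cong m (λ x → ∑-cong n (λ y → trans
         (cong₂ (λ a b → F a ℕ.* G b) (take-++ x y) (drop-++ x y))
         (ℕ.*-comm (F x) (G y)))) ⟩
  ∑ m (λ x → ∑ n (λ y → G y ℕ.* F x))
    ≡⟨ ∑-cong m (λ x → trans (∑-*ʳ n G (F x)) (ℕ.*-comm _ (F x))) ⟩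
  ∑ m (λ x → F x ℕ.* ∑ n G)
    ≡⟨ ∑-*ʳ m F (∑ n G) ⟩
  ∑ m F ℕ.* ∑ n G ∎
  where open ≡-Reasoning

𝟙 : Bool → ℕ
𝟙 b = if b then 1 else 0

𝟙≤ : ∀ {P : Set} (P? : Dec P) {c} → (P → 1 ≤ℕ c) → 𝟙 (does P?) ≤ℕ c
𝟙≤ (yes p) h = h p
𝟙≤ (no _)  h = z≤n

#≡∑ : ∀ m {P : Pred (Cube m) _} (P? : Decidable P) → # P? ≡ ∑ m (λ x → 𝟙 (does (P? x)))
#≡∑ zero P? with does (P? [])
... | false = refl
... | true  = refl
#≡∑ (suc m) P? = begin
  length (filter P? (List.map (false ∷_) (cube m) List.++ List.map (true ∷_) (cube m) List.++ []))
    ≡⟨ count-++ (List.map (false ∷_) (cube m)) _ ⟩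
  length (filter P? (List.map (false ∷_) (cube m))) +
  length (filter P? (List.map (true ∷_) (cube m) List.++ []))
    ≡⟨ cong (λ l → length (filter P? (List.map (false ∷_) (cube m))) + length (filter P? l)) (List.++-identityʳ (List.map (true ∷_) (cube m))) ⟩
  length (filter P? (List.map (false ∷_) (cube m))) +
  length (filter P? (List.map (true ∷_) (cube m)))
    ≡⟨ cong₂ _+_ (count-map (cube m)) (count-map (cube m)) ⟩
  # (P? ∘ (false ∷_)) + # (P? ∘ (true ∷_))
    ≡⟨ cong₂ _+_ (#≡∑ m (P? ∘ (false ∷_))) (#≡∑ m (P? ∘ (true ∷_))) ⟩
  ∑ (suc m) (λ x → 𝟙 (does (P? x))) ∎
  where
  open ≡-Reasoning
  count-++ : ∀ xs ys → length (filter P? (xs List.++ ys)) ≡ length (filter P? xs) + length (filter P? ys)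
  count-++ xs ys = trans (cong length (List.filter-++ P? xs ys)) (List.length-++ (filter P? xs))
  count-map : ∀ {b} xs → length (filter P? (List.map (b ∷_) xs)) ≡ length (filter (P? ∘ (b ∷_)) xs)
  count-map [] = refl
  count-map {b} (x ∷ xs) with does (P? (b ∷ x))
  ... | false = count-map xs
  ... | true  = cong suc (count-map xs)

-- The flat lattice

data Flat (J : ℕ) : Set where
  bot top : Flat J
  mid     : Fin J → Flat J

infix 4 _⊑_

data _⊑_ {J : ℕ} : Flat J → Flat J → Set where
  bot⊑ : ∀ {s} → bot ⊑ s
  ⊑top : ∀ {s} → s ⊑ top
  mid⊑ : ∀ {j} → mid j ⊑ mid j

map : (Fin J → Fin J′) → Flat J → Flat J′
map ι bot     = bot
map ι top     = top
map ι (mid j) = mid (ι j)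

map-mono : (ι : Fin J → Fin J′) {s t : Flat J} → s ⊑ t → map ι s ⊑ map ι t
map-mono ι bot⊑ = bot⊑
map-mono ι ⊑top = ⊑top
map-mono ι mid⊑ = mid⊑

isBot isMid : Flat J → ℕ
isBot bot     = 1
isBot top     = 0
isBot (mid _) = 0
isMid bot     = 0
isMid top     = 0
isMid (mid _) = 1

hit : Fin J → Flat J → ℕ
hit i bot     = 0
hit i top     = 0
hit i (mid j) = 𝟙 (does (i Fin.≟ j))

hit-mid : (i : Fin J) → hit i (mid i) ≡ 1
hit-mid i with i Fin.≟ i
... | yes _  = refl
... | no i≢i = ⊥-elim (i≢i refl)

-- Bounds on level probabilities go through this form, which leaves only the case `s ≡ mid i` to
-- check.
hit≤ : ∀ (i : Fin J) s {c} → (s ≡ mid i → 1 ≤ℕ c) → hit i s ≤ℕ c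
hit≤ i bot     h = z≤n
hit≤ i top     h = z≤n
hit≤ i (mid j) h = 𝟙≤ (i Fin.≟ j) λ { refl → h refl }

-- A level has probability at most 1 / p, all levels together at least 1 / u.
record Selector (v J p u : ℕ) : Set where
  field
    select      : Cube v → Flat J
    select-mono : ∀ {x y} → x ≼ y → select x ⊑ select y
    rare        : ∀ i → ∑ v (hit i ∘ select) ℕ.* p ≤ℕ 2 ^ v
    frequent    : 2 ^ v ≤ℕ u ℕ.* ∑ v (isMid ∘ select)

open Selector

-- Lexicographic products of selectors

≼-take : ∀ m {n} {x y : Cube (m + n)} → x ≼ y → take m x ≼ take m y
≼-take (suc m) {x = _ ∷ _} {_ ∷ _} x≼y zero    = x≼y zero
≼-take (suc m) {x = _ ∷ _} {_ ∷ _} x≼y (suc i) = ≼-take m (x≼y ∘ suc) i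

≼-drop : ∀ m {n} {x y : Cube (m + n)} → x ≼ y → drop m x ≼ drop m y
≼-drop zero    x≼y = x≼y
≼-drop (suc m) {x = _ ∷ _} {_ ∷ _} x≼y = ≼-drop m (x≼y ∘ suc)

lex : Flat J → Flat J′ → Flat (J ℕ.* J′)
lex bot     t = bot
lex top     t = top
lex (mid j) t = map (combine j) t

-- Distinct levels are incomparable. So either the first argument stays at one level and the second
-- decides, or the smaller first argument is `bot` or the larger is `top`, which settles the
-- comparison.
lex-mono : {s s′ : Flat J} {t t′ : Flat J′} → s ⊑ s′ → t ⊑ t′ → lex s t ⊑ lex s′ t′
lex-mono         bot⊑ q = bot⊑
lex-mono         ⊑top q = ⊑top
lex-mono {s = mid j} mid⊑ q = map-mono (combine j) q

isMid-lex : (s : Flat J) (t : Flat J′) → isMid (lex s t) ≡ isMid s ℕ.* isMid t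
isMid-lex bot     t       = refl
isMid-lex top     t       = refl
isMid-lex (mid j) bot     = refl
isMid-lex (mid j) top     = refl
isMid-lex (mid j) (mid k) = refl

-- By injectivity of `combine`, the product reaches the level of the pair only if both factors reach
-- theirs.
hit-lex : (j : Fin J) (k : Fin J′) (s : Flat J) (t : Flat J′) →
          hit (combine j k) (lex s t) ≤ℕ hit j s ℕ.* hit k t
hit-lex j k s t = hit≤ (combine j k) (lex s t) (both s t)
  where
  both : ∀ s t → lex s t ≡ mid (combine j k) → 1 ≤ℕ hit j s ℕ.* hit k t
  both (mid j′) (mid k′) e with combine j′ k′ in c | e
  ... | _ | refl with Fin.combine-injective j′ k′ j k c
  ... | refl , refl rewrite hit-mid j | hit-mid k = s≤s z≤n

lexSelector : Selector v J p u → Selector v′ J′ p′ u′ →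
              Selector (v + v′) (J ℕ.* J′) (p ℕ.* p′) (u ℕ.* u′)
lexSelector {v} {J} {p} {u} {v′} {J′} {p′} {u′} S T = record
  { select      = λ z → lex (select S (take v z)) (select T (drop v z))
  ; select-mono = λ x≼y → lex-mono (select-mono S (≼-take v x≼y)) (select-mono T (≼-drop v x≼y))
  -- Every level of the product is the code of a pair, so it is enough to bound those.
  ; rare        = λ i → let j , k , e = Fin.combine-surjective {J} {J′} i in subst Rare e (rare′ j k)
  ; frequent    = begin
      2 ^ (v + v′)                             ≡⟨ ℕ.^-distribˡ-+-* 2 v v′ ⟩
      2 ^ v ℕ.* 2 ^ v′                         ≤⟨ ℕ.*-mono-≤ (frequent S) (frequent T) ⟩
      (u ℕ.* ∑ v F) ℕ.* (u′ ℕ.* ∑ v′ G)        ≡⟨ interchange u (∑ v F) u′ (∑ v′ G) ⟩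
      (u ℕ.* u′) ℕ.* (∑ v F ℕ.* ∑ v′ G)        ≡⟨ cong ((u ℕ.* u′) ℕ.*_) (∑-* v F G) ⟨
      (u ℕ.* u′) ℕ.* ∑ (v + v′) (λ z → F (take v z) ℕ.* G (drop v z))
        ≡⟨ cong ((u ℕ.* u′) ℕ.*_) (∑-cong (v + v′) λ z → isMid-lex (select S (take v z)) _) ⟨
      (u ℕ.* u′) ℕ.* ∑ (v + v′) (λ z → isMid (lex (select S (take v z)) (select T (drop v z)))) ∎
  }
  where
  open ℕ.≤-Reasoning
  F = isMid ∘ select S
  G = isMid ∘ select T
  interchange : ∀ a b c d → (a ℕ.* b) ℕ.* (c ℕ.* d) ≡ (a ℕ.* c) ℕ.* (b ℕ.* d)
  interchange = solve-∀
  Rare : Fin (J ℕ.* J′) → Set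
  Rare i = ∑ (v + v′) (λ z → hit i (lex (select S (take v z)) (select T (drop v z)))) ℕ.* (p ℕ.* p′)
             ≤ℕ 2 ^ (v + v′)
  rare′ : ∀ j k → Rare (combine j k)
  rare′ j k = begin
    ∑ (v + v′) (λ z → hit (combine j k) (lex (select S (take v z)) (select T (drop v z)))) ℕ.* (p ℕ.* p′)
      ≤⟨ ℕ.*-monoˡ-≤ (p ℕ.* p′) (∑-mono (v + v′) λ z → hit-lex j k (select S (take v z)) _) ⟩
    ∑ (v + v′) (λ z → hit j (select S (take v z)) ℕ.* hit k (select T (drop v z))) ℕ.* (p ℕ.* p′)
      ≡⟨ cong (ℕ._* (p ℕ.* p′)) (∑-* v (hit j ∘ select S) (hit k ∘ select T)) ⟩
    (∑ v (hit j ∘ select S) ℕ.* ∑ v′ (hit k ∘ select T)) ℕ.* (p ℕ.* p′)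
      ≡⟨ interchange (∑ v (hit j ∘ select S)) _ p p′ ⟩
    (∑ v (hit j ∘ select S) ℕ.* p) ℕ.* (∑ v′ (hit k ∘ select T) ℕ.* p′)
      ≤⟨ ℕ.*-mono-≤ (rare S j) (rare T k) ⟩
    2 ^ v ℕ.* 2 ^ v′ ≡⟨ ℕ.^-distribˡ-+-* 2 v v′ ⟨
    2 ^ (v + v′) ∎

-- With a single level that is always selected, this factor adds `v` dummy variables to a product
-- and multiplies all other parameters by 1, as `pad` requires.
constSelector : ∀ v → Selector v 1 1 1
constSelector v = record
  { select      = λ _ → mid zero
  ; select-mono = λ _ → mid⊑
  ; rare        = λ { zero → ℕ.≤-reflexive (trans (ℕ.*-identityʳ _) (∑-1 v)) }
  ; frequent    = ℕ.≤-reflexive (sym (trans (ℕ.+-identityʳ _) (∑-1 v)))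
  }

pad : v ≤ℕ v′ → Selector v J p u → Selector v′ J p u
pad {J = J} {p} {u} v≤v′ S
  with r , refl ← ℕ.m≤n⇒∃[o]m+o≡n v≤v′
  with T ← lexSelector S (constSelector r)
  rewrite ℕ.*-identityʳ J | ℕ.*-identityʳ p | ℕ.*-identityʳ u = T

-- Tribes

allTrue : Cube m → Bool
allTrue []      = true
allTrue (b ∷ x) = b ∧ allTrue x

allTrue-mono : (x y : Cube m) → x ≼ y → allTrue x Bool.≤ allTrue y
allTrue-mono []      []      _   = Bool.b≤b
allTrue-mono (_ ∷ x) (_ ∷ y) x≼y = ∧-mono (x≼y zero) (allTrue-mono x y (x≼y ∘ suc))
  where
  ∧-mono : ∀ {a b c d} → a Bool.≤ b → c Bool.≤ d → a ∧ c Bool.≤ b ∧ d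
  ∧-mono         Bool.f≤t q = Bool.≤-minimum _
  ∧-mono {false} Bool.b≤b q = Bool.b≤b
  ∧-mono {true}  Bool.b≤b q = q

-- `s` records whether none, exactly one or several of the remaining tribes are all ones; the added
-- tribe receives index `zero`.
addTribe : Bool → Flat J → Flat (suc J)
addTribe false s       = map suc s
addTribe true  bot     = mid zero
addTribe true  top     = top
addTribe true  (mid _) = top

addTribe-mono : ∀ {b c} {s t : Flat J} → b Bool.≤ c → s ⊑ t → addTribe b s ⊑ addTribe c t
addTribe-mono         Bool.f≤t bot⊑         = bot⊑
addTribe-mono         Bool.f≤t ⊑top         = ⊑top
addTribe-mono         Bool.f≤t mid⊑         = ⊑top
addTribe-mono {b = false} Bool.b≤b s⊑t      = map-mono suc s⊑t
addTribe-mono {b = true}  Bool.b≤b (bot⊑ {bot})   = mid⊑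
addTribe-mono {b = true}  Bool.b≤b (bot⊑ {top})   = ⊑top
addTribe-mono {b = true}  Bool.b≤b (bot⊑ {mid _}) = ⊑top
addTribe-mono {b = true}  Bool.b≤b ⊑top     = ⊑top
addTribe-mono {b = true}  Bool.b≤b mid⊑     = ⊑top

isBot-addTribe : ∀ b (s : Flat J) → isBot (addTribe b s) ≡ 𝟙 (not b) ℕ.* isBot s
isBot-addTribe false bot     = refl
isBot-addTribe false top     = refl
isBot-addTribe false (mid _) = refl
isBot-addTribe true  bot     = refl
isBot-addTribe true  top     = refl
isBot-addTribe true  (mid _) = refl

isMid-addTribe : ∀ b (s : Flat J) →
                 isMid (addTribe b s) ≡ 𝟙 b ℕ.* isBot s + 𝟙 (not b) ℕ.* isMid s
isMid-addTribe false bot     = refl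
isMid-addTribe false top     = refl
isMid-addTribe false (mid _) = refl
isMid-addTribe true  bot     = refl
isMid-addTribe true  top     = refl
isMid-addTribe true  (mid _) = refl

hit-zero-addTribe : ∀ b (s : Flat J) → hit zero (addTribe b s) ≤ℕ 𝟙 b ℕ.* isBot s
hit-zero-addTribe false bot     = z≤n
hit-zero-addTribe false top     = z≤n
hit-zero-addTribe false (mid _) = z≤n
hit-zero-addTribe true  bot     = ℕ.≤-refl
hit-zero-addTribe true  top     = z≤n
hit-zero-addTribe true  (mid _) = z≤n

hit-suc-addTribe : ∀ j b (s : Flat J) → hit (suc j) (addTribe b s) ≤ℕ 𝟙 (not b) ℕ.* hit j s
hit-suc-addTribe j b s = hit≤ (suc j) (addTribe b s) (old b s)
  where
  old : ∀ b s → addTribe b s ≡ mid (suc j) → 1 ≤ℕ 𝟙 (not b) ℕ.* hit j s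
  old false (mid j) refl rewrite hit-mid j = s≤s z≤n
  old true  bot     ()
  old true  top     ()
  old true  (mid _) ()

tribes : ∀ w N → Cube (N ℕ.* w) → Flat N
tribes w zero    _ = bot
tribes w (suc N) x = addTribe (allTrue (take w x)) (tribes w N (drop w x))

tribes-mono : ∀ w N x y → x ≼ y → tribes w N x ⊑ tribes w N y
tribes-mono w zero    x y x≼y = bot⊑
tribes-mono w (suc N) x y x≼y =
  addTribe-mono (allTrue-mono (take w x) (take w y) (≼-take w x≼y))
                (tribes-mono w N (drop w x) (drop w y) (≼-drop w x≼y))

∑-allTrue : ∀ w → ∑ w (𝟙 ∘ allTrue) ≡ 1
∑-allTrue zero = refl
∑-allTrue (suc w) rewrite ∑-const w 0 | ℕ.*-zeroʳ (2 ^ w) = ∑-allTrue w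

-- This is 2^w - 1; the sum fits `∑-*`, and `suc-misses` gives the value without truncated
-- subtraction.
misses : ℕ → ℕ
misses w = ∑ w (𝟙 ∘ not ∘ allTrue)

suc-misses : ∀ w → suc (misses w) ≡ 2 ^ w
suc-misses w = begin
  suc (misses w)                                          ≡⟨ cong (_+ misses w) (∑-allTrue w) ⟨
  ∑ w (𝟙 ∘ allTrue) + misses w                            ≡⟨ ∑-+ w (𝟙 ∘ allTrue) _ ⟨
  ∑ w (λ x → 𝟙 (allTrue x) + 𝟙 (not (allTrue x)))         ≡⟨ ∑-cong w (λ x → either (allTrue x)) ⟩
  ∑ w (λ _ → 1)                                           ≡⟨ ∑-1 w ⟩
  2 ^ w ∎
  where
  open ≡-Reasoning
  either : ∀ b → 𝟙 b + 𝟙 (not b) ≡ 1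
  either false = refl
  either true  = refl

misses≤ : ∀ w → misses w ≤ℕ 2 ^ w
misses≤ w = ℕ.≤-trans (ℕ.n≤1+n _) (ℕ.≤-reflexive (suc-misses w))

bots mids : ℕ → ℕ → ℕ
bots w N = ∑ (N ℕ.* w) (isBot ∘ tribes w N)
mids w N = ∑ (N ℕ.* w) (isMid ∘ tribes w N)

bots≡ : ∀ w N → bots w N ≡ misses w ^ N
bots≡ w zero    = refl
bots≡ w (suc N) = begin
  bots w (suc N)          ≡⟨ ∑-cong (suc N ℕ.* w) (λ x → isBot-addTribe (allTrue (take w x)) _) ⟩
  ∑ (suc N ℕ.* w) (λ x → 𝟙 (not (allTrue (take w x))) ℕ.* isBot (tribes w N (drop w x)))
                          ≡⟨ ∑-* w (𝟙 ∘ not ∘ allTrue) (isBot ∘ tribes w N) ⟩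
  misses w ℕ.* bots w N   ≡⟨ cong (misses w ℕ.*_) (bots≡ w N) ⟩
  misses w ^ suc N ∎
  where open ≡-Reasoning

-- Exactly one tribe is all ones: either the first, in one way, with all the others missing, or one
-- of the others while the first misses.
mids-suc : ∀ w N → mids w (suc N) ≡ bots w N + misses w ℕ.* mids w N
mids-suc w N = begin
  mids w (suc N)          ≡⟨ ∑-cong (suc N ℕ.* w) (λ x → isMid-addTribe (allTrue (take w x)) _) ⟩
  ∑ (suc N ℕ.* w) (λ x → 𝟙 (allTrue (take w x)) ℕ.* isBot (tribes w N (drop w x))
                       + 𝟙 (not (allTrue (take w x))) ℕ.* isMid (tribes w N (drop w x)))
    ≡⟨ ∑-+ (suc N ℕ.* w) _ _ ⟩
  ∑ (suc N ℕ.* w) (λ x → 𝟙 (allTrue (take w x)) ℕ.* isBot (tribes w N (drop w x))) +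
  ∑ (suc N ℕ.* w) (λ x → 𝟙 (not (allTrue (take w x))) ℕ.* isMid (tribes w N (drop w x)))
    ≡⟨ cong₂ _+_ (∑-* w (𝟙 ∘ allTrue) (isBot ∘ tribes w N))
                 (∑-* w (𝟙 ∘ not ∘ allTrue) (isMid ∘ tribes w N)) ⟩
  ∑ w (𝟙 ∘ allTrue) ℕ.* bots w N + misses w ℕ.* mids w N
    ≡⟨ cong (λ c → c ℕ.* bots w N + misses w ℕ.* mids w N) (∑-allTrue w) ⟩
  1 ℕ.* bots w N + misses w ℕ.* mids w N
    ≡⟨ cong (_+ misses w ℕ.* mids w N) (ℕ.*-identityˡ (bots w N)) ⟩
  bots w N + misses w ℕ.* mids w N ∎
  where open ≡-Reasoning

-- Choose the tribe that is all ones; each of the other `M` tribes misses independently. Writing the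
-- number of tribes as `suc M` keeps a predecessor out of the exponent.
mids≡ : ∀ w M → mids w (suc M) ≡ suc M ℕ.* misses w ^ M
mids≡ w zero = begin
  mids w 1            ≡⟨ mids-suc w 0 ⟩
  1 + misses w ℕ.* 0  ≡⟨ cong suc (ℕ.*-zeroʳ (misses w)) ⟩
  1                   ∎
  where open ≡-Reasoning
mids≡ w (suc M) = begin
  mids w (2 + M)
    ≡⟨ mids-suc w (suc M) ⟩
  bots w (suc M) + misses w ℕ.* mids w (suc M)
    ≡⟨ cong₂ (λ a b → a + misses w ℕ.* b) (bots≡ w (suc M)) (mids≡ w M) ⟩
  misses w ^ suc M + misses w ℕ.* (suc M ℕ.* misses w ^ M)
    ≡⟨ collect (misses w) (misses w ^ M) M ⟩
  (2 + M) ℕ.* misses w ^ suc M ∎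
  where
  open ≡-Reasoning
  collect : ∀ q r M → q ℕ.* r + q ℕ.* ((1 + M) ℕ.* r) ≡ (2 + M) ℕ.* (q ℕ.* r)
  collect = solve-∀

^-tribes : ∀ w N → (2 ^ w) ^ N ≡ 2 ^ (N ℕ.* w)
^-tribes w N = trans (ℕ.^-*-assoc 2 w N) (cong (2 ^_) (ℕ.*-comm w N))

-- Level `j` forces tribe `j` to be all ones, which has probability 1 / 2^w; that the other tribes
-- miss is bounded by probability 1 through `misses≤`.
tribes-rare : ∀ w N j → ∑ (N ℕ.* w) (hit j ∘ tribes w N) ℕ.* 2 ^ w ≤ℕ (2 ^ w) ^ N
tribes-rare w (suc N) zero = begin
  ∑ (suc N ℕ.* w) (hit zero ∘ tribes w (suc N)) ℕ.* 2 ^ w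
    ≤⟨ ℕ.*-monoˡ-≤ (2 ^ w) (∑-mono (suc N ℕ.* w) λ x → hit-zero-addTribe (allTrue (take w x)) _) ⟩
  ∑ (suc N ℕ.* w) (λ x → 𝟙 (allTrue (take w x)) ℕ.* isBot (tribes w N (drop w x))) ℕ.* 2 ^ w
    ≡⟨ cong (ℕ._* 2 ^ w) (∑-* w (𝟙 ∘ allTrue) (isBot ∘ tribes w N)) ⟩
  ∑ w (𝟙 ∘ allTrue) ℕ.* bots w N ℕ.* 2 ^ w
    ≡⟨ cong₂ (λ a b → a ℕ.* b ℕ.* 2 ^ w) (∑-allTrue w) (bots≡ w N) ⟩
  1 ℕ.* misses w ^ N ℕ.* 2 ^ w
    ≡⟨ trans (cong (ℕ._* 2 ^ w) (ℕ.*-identityˡ (misses w ^ N))) (ℕ.*-comm (misses w ^ N) (2 ^ w)) ⟩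
  2 ^ w ℕ.* misses w ^ N
    ≤⟨ ℕ.*-monoʳ-≤ (2 ^ w) (ℕ.^-monoˡ-≤ N (misses≤ w)) ⟩
  (2 ^ w) ^ suc N ∎
  where open ℕ.≤-Reasoning
tribes-rare w (suc N) (suc j) = begin
  ∑ (suc N ℕ.* w) (hit (suc j) ∘ tribes w (suc N)) ℕ.* 2 ^ w
    ≤⟨ ℕ.*-monoˡ-≤ (2 ^ w) (∑-mono (suc N ℕ.* w) λ x → hit-suc-addTribe j (allTrue (take w x)) _) ⟩
  ∑ (suc N ℕ.* w) (λ x → 𝟙 (not (allTrue (take w x))) ℕ.* hit j (tribes w N (drop w x))) ℕ.* 2 ^ w
    ≡⟨ cong (ℕ._* 2 ^ w) (∑-* w (𝟙 ∘ not ∘ allTrue) (hit j ∘ tribes w N)) ⟩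
  misses w ℕ.* ∑ (N ℕ.* w) (hit j ∘ tribes w N) ℕ.* 2 ^ w
    ≡⟨ ℕ.*-assoc (misses w) _ (2 ^ w) ⟩
  misses w ℕ.* (∑ (N ℕ.* w) (hit j ∘ tribes w N) ℕ.* 2 ^ w)
    ≤⟨ ℕ.*-mono-≤ (misses≤ w) (tribes-rare w N j) ⟩
  (2 ^ w) ^ suc N ∎
  where open ℕ.≤-Reasoning

-- (1 - 1/(1+q))^M ≥ 1 - M/(1+q), cleared of denominators and subtraction.
bernoulli : ∀ q M → suc q ^ M ℕ.* suc q ≤ℕ q ^ M ℕ.* suc q + M ℕ.* suc q ^ M
bernoulli q zero    = ℕ.m≤m+n _ _
bernoulli q (suc M) = begin
  Q ℕ.* Q ^ M ℕ.* Q                                    ≡⟨ ℕ.*-assoc Q (Q ^ M) Q ⟩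
  Q ℕ.* (Q ^ M ℕ.* Q)                                  ≤⟨ ℕ.*-monoʳ-≤ Q (bernoulli q M) ⟩
  Q ℕ.* (q ^ M ℕ.* Q + M ℕ.* Q ^ M)                    ≡⟨ expand q (q ^ M) M (Q ^ M) ⟩
  q ^ suc M ℕ.* Q + (q ^ M ℕ.* Q + M ℕ.* Q ^ suc M)
    ≤⟨ ℕ.+-monoʳ-≤ (q ^ suc M ℕ.* Q) (ℕ.+-monoˡ-≤ (M ℕ.* Q ^ suc M) (begin
         q ^ M ℕ.* Q ≤⟨ ℕ.*-monoˡ-≤ Q (ℕ.^-monoˡ-≤ M (ℕ.n≤1+n q)) ⟩
         Q ^ M ℕ.* Q ≡⟨ ℕ.*-comm (Q ^ M) Q ⟩
         Q ^ suc M   ∎)) ⟩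
  q ^ suc M ℕ.* Q + suc M ℕ.* Q ^ suc M ∎
  where
  open ℕ.≤-Reasoning
  Q = suc q
  expand : ∀ q a M b → (1 + q) ℕ.* (a ℕ.* (1 + q) + M ℕ.* b)
                     ≡ q ℕ.* a ℕ.* (1 + q) + (a ℕ.* (1 + q) + M ℕ.* ((1 + q) ℕ.* b))
  expand = solve-∀

-- With N = M + 1 and Q = 2^w = 2N, the probability of a level is (N/Q)(1 - 1/Q)^M, at least (1/2)(1
-- - M/Q) by `bernoulli`, hence at least 1/4 because M/Q is below 1/2.
tribes-frequent : ∀ w M → 2 ^ w ≡ 2 ℕ.* suc M → (2 ^ w) ^ suc M ≤ℕ 4 ℕ.* mids w (suc M)
tribes-frequent w M 2^w≡2N rewrite mids≡ w M | sym (suc-misses w) =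
  -- The negative term of Bernoulli's inequality is kept on the other side, where it is at most half
  -- of the doubled left side; the summand `Q ^ suc M` absorbs it.
  ℕ.+-cancelʳ-≤ (Q ^ suc M) _ _ (begin
    Q ^ suc M + Q ^ suc M                                     ≡⟨ double Q (Q ^ M) ⟩
    2 ℕ.* (Q ^ M ℕ.* Q)                                       ≤⟨ ℕ.*-monoʳ-≤ 2 (bernoulli q M) ⟩
    2 ℕ.* (q ^ M ℕ.* Q + M ℕ.* Q ^ M)                         ≡⟨ cong (λ c → 2 ℕ.* (q ^ M ℕ.* c + M ℕ.* Q ^ M)) 2^w≡2N ⟩
    2 ℕ.* (q ^ M ℕ.* (2 ℕ.* suc M) + M ℕ.* Q ^ M)             ≡⟨ regroup (q ^ M) M (Q ^ M) ⟩
    4 ℕ.* (suc M ℕ.* q ^ M) + 2 ℕ.* M ℕ.* Q ^ M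
      ≤⟨ ℕ.+-monoʳ-≤ (4 ℕ.* (suc M ℕ.* q ^ M)) (ℕ.*-monoˡ-≤ (Q ^ M) (begin
           2 ℕ.* M     ≤⟨ ℕ.*-monoʳ-≤ 2 (ℕ.n≤1+n M) ⟩
           2 ℕ.* suc M ≡⟨ 2^w≡2N ⟨
           Q           ∎)) ⟩
    4 ℕ.* (suc M ℕ.* q ^ M) + Q ^ suc M ∎)
  where
  open ℕ.≤-Reasoning
  q = misses w
  Q = suc q
  double : ∀ Q a → Q ℕ.* a + Q ℕ.* a ≡ 2 ℕ.* (a ℕ.* Q)
  double = solve-∀
  regroup : ∀ a M b → 2 ℕ.* (a ℕ.* (2 ℕ.* (1 + M)) + M ℕ.* b) ≡ 4 ℕ.* ((1 + M) ℕ.* a) + 2 ℕ.* M ℕ.* b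
  regroup = solve-∀

tribesSelector : ∀ w N .{{_ : NonZero N}} → 2 ^ w ≡ 2 ℕ.* N → Selector (N ℕ.* w) N (2 ^ w) 4
tribesSelector w N@(suc M) 2^w≡2N = record
  { select      = tribes w N
  ; select-mono = tribes-mono w N _ _
  ; rare        = λ j → ℕ.≤-trans (tribes-rare w N j) (ℕ.≤-reflexive (^-tribes w N))
  ; frequent    = ℕ.≤-trans (ℕ.≤-reflexive (sym (^-tribes w N))) (tribes-frequent w M 2^w≡2N)
  }

-- Negated dictators on the levels of a selector

answer : Flat J → BoolFun J
answer bot     y = false
answer top     y = true
answer (mid j) y = not (lookup y j)

answer-mono : ∀ {s t : Flat J} y → s ⊑ t → answer s y Bool.≤ answer t y
answer-mono y bot⊑ = Bool.≤-minimum _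
answer-mono y ⊑top = Bool.≤-maximum _
answer-mono y mid⊑ = Bool.b≤b

-- At `bot` and `top` the answer does not depend on `y`, and at level `j` it reads only coordinate
-- `j`.
answer-sensitive : ∀ (s : Flat J) y i → answer s (y ⊕ i) Bool.< answer s y → s ≡ mid i
answer-sensitive (mid j) y i lt with j Fin.≟ i
... | yes refl = refl
... | no j≢i   = ⊥-elim (Bool.<-irrefl (cong not (Vec.lookup∘updateAt′ j i j≢i y)) lt)

<⇒≰ : ∀ {a b} → a Bool.< b → ¬ (b Bool.≤ a)
<⇒≰ Bool.f<t ()

take-⊕ʳ : ∀ m (z : Cube (m + n)) i → take m (z ⊕ (m ↑ʳ i)) ≡ take m z
take-⊕ʳ zero    z       i = refl
take-⊕ʳ (suc m) (b ∷ z) i = cong (b ∷_) (take-⊕ʳ m z i)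

drop-⊕ʳ : ∀ m (z : Cube (m + n)) i → drop m (z ⊕ (m ↑ʳ i)) ≡ drop m z ⊕ i
drop-⊕ʳ zero    z       i = refl
drop-⊕ʳ (suc m) (b ∷ z) i = drop-⊕ʳ m z i

drop-⊕ˡ : ∀ m (z : Cube (m + n)) i → drop m (z ⊕ (i ↑ˡ n)) ≡ drop m z
drop-⊕ˡ (suc m) (b ∷ z) zero    = refl
drop-⊕ˡ (suc m) (b ∷ z) (suc i) = drop-⊕ˡ m z i

≼-⊕ : ∀ (y : Cube n) i → lookup y i ≡ false → y ≼ y ⊕ i
≼-⊕ (false ∷ y) zero    refl zero    = Bool.f≤t
≼-⊕ (false ∷ y) zero    refl (suc k) = Bool.b≤b
≼-⊕ (b ∷ y)     (suc i) e    zero    = Bool.b≤b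
≼-⊕ (b ∷ y)     (suc i) e    (suc k) = ≼-⊕ y i e k

⊕-≼ : ∀ (y : Cube n) i → lookup y i ≡ true → y ⊕ i ≼ y
⊕-≼ (true ∷ y) zero    refl zero    = Bool.f≤t
⊕-≼ (true ∷ y) zero    refl (suc k) = Bool.b≤b
⊕-≼ (b ∷ y)    (suc i) e    zero    = Bool.b≤b
⊕-≼ (b ∷ y)    (suc i) e    (suc k) = ⊕-≼ y i e k

++-≼ : ∀ (x : Cube m) {y z : Cube n} → y ≼ z → x ++ y ≼ x ++ z
++-≼ []      y≼z k       = y≼z k
++-≼ (b ∷ x) y≼z zero    = Bool.b≤b
++-≼ (b ∷ x) y≼z (suc k) = ++-≼ x y≼z k

differ : BoolFun m → BoolFun m → Cube m → ℕ
differ f g z = 𝟙 (does (¬? (f z Bool.≟ g z)))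

-- `f` drops from `z` to `z′` and `g` does not, so they disagree at one of the two endpoints.
violated-edge : ∀ (f g : BoolFun m) z z′ → f z ≡ true → f z′ ≡ false → g z Bool.≤ g z′ →
                1 ≤ℕ differ f g z + differ f g z′
violated-edge f g z z′ ft ff g≤ rewrite ft | ff with g z | g z′ | g≤
... | _     | _ | Bool.f≤t = s≤s z≤n
... | false | _ | Bool.b≤b = s≤s z≤n
... | true  | _ | Bool.b≤b = s≤s z≤n

module _ (S : Selector v J p u) where

  selected : BoolFun (v + J)
  selected z = answer (select S (take v z)) (drop v z)

  selected-++ : ∀ x y → selected (x ++ y) ≡ answer (select S x) y
  selected-++ x y = cong₂ (λ x y → answer (select S x) y) (take-++ x y) (drop-++ x y)

  -- An upward flip in the first block moves `select` up and fixes `y`, so by `answer-mono` the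
  -- value cannot drop.
  #negEdge-↑ˡ : ∀ i → # (negEdge? selected (i ↑ˡ J)) ≡ 0
  #negEdge-↑ˡ i = cong length (List.filter-none (negEdge? selected (i ↑ˡ J))
                                (All.universal noNegEdge (cube (v + J))))
    where
    noNegEdge : ∀ z → ¬ NegEdge selected (i ↑ˡ J) z
    noNegEdge z (f< , z≼) rewrite drop-⊕ˡ v z i =
      <⇒≰ f< (answer-mono (drop v z) (select-mono S (≼-take v z≼)))

  -- A negative edge in direction `i` needs `select` to give level `i`. Counting all `y`, and not
  -- only those with coordinate `i` false, costs a factor 2.
  #negEdge-↑ʳ : ∀ i → # (negEdge? selected (v ↑ʳ i)) ℕ.* p ≤ℕ 2 ^ (v + J)
  #negEdge-↑ʳ i = begin
    # (negEdge? selected (v ↑ʳ i)) ℕ.* p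
      ≡⟨ cong (ℕ._* p) (#≡∑ (v + J) (negEdge? selected (v ↑ʳ i))) ⟩
    ∑ (v + J) (λ z → 𝟙 (does (negEdge? selected (v ↑ʳ i) z))) ℕ.* p
      ≤⟨ ℕ.*-monoˡ-≤ p (∑-mono (v + J) negEdge≤hit) ⟩
    -- The factor 1, seen as a function of the second block, gives the summand the product shape of
    -- `∑-*`.
    ∑ (v + J) (λ z → hit i (select S (take v z)) ℕ.* 1) ℕ.* p
      ≡⟨ cong (ℕ._* p) (∑-* v (hit i ∘ select S) (λ _ → 1)) ⟩
    ∑ v (hit i ∘ select S) ℕ.* ∑ J (λ _ → 1) ℕ.* p
      ≡⟨ swap (∑ v (hit i ∘ select S)) _ p ⟩
    ∑ v (hit i ∘ select S) ℕ.* p ℕ.* ∑ J (λ _ → 1)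
      ≤⟨ ℕ.*-mono-≤ (rare S i) (ℕ.≤-reflexive (∑-1 J)) ⟩
    2 ^ v ℕ.* 2 ^ J
      ≡⟨ ℕ.^-distribˡ-+-* 2 v J ⟨
    2 ^ (v + J) ∎
    where
    open ℕ.≤-Reasoning
    swap : ∀ a b c → a ℕ.* b ℕ.* c ≡ a ℕ.* c ℕ.* b
    swap = solve-∀
    negEdge⇒mid : ∀ z → NegEdge selected (v ↑ʳ i) z → select S (take v z) ≡ mid i
    negEdge⇒mid z (f< , _) rewrite take-⊕ʳ v z i | drop-⊕ʳ v z i =
      answer-sensitive (select S (take v z)) (drop v z) i f<
    negEdge≤hit : ∀ z → 𝟙 (does (negEdge? selected (v ↑ʳ i) z)) ≤ℕ hit i (select S (take v z)) ℕ.* 1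
    negEdge≤hit z = 𝟙≤ (negEdge? selected (v ↑ʳ i) z) hit≥1
      where
      hit≥1 : NegEdge selected (v ↑ʳ i) z → 1 ≤ℕ hit i (select S (take v z)) ℕ.* 1
      hit≥1 e rewrite negEdge⇒mid z e | hit-mid i = s≤s z≤n

  -- When select S x = mid j, flipping y_j pairs up the fibre over x into
  -- violated edges, and g differs from selected on each of them.
  fibre-distance : ∀ g → Monotone g → ∀ x →
    2 ^ J ℕ.* isMid (select S x) ≤ℕ 2 ℕ.* ∑ J (λ y → differ selected g (x ++ y))
  fibre-distance g mono x with select S x in sel
  ... | bot   rewrite ℕ.*-zeroʳ (2 ^ J) = z≤n
  ... | top   rewrite ℕ.*-zeroʳ (2 ^ J) = z≤n
  ... | mid j = begin
    2 ^ J ℕ.* 1                                     ≡⟨ ∑-const J 1 ⟨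
    ∑ J (λ _ → 1)                                   ≤⟨ ∑-mono J violated ⟩
    ∑ J (λ y → D y + D (y ⊕ j))                     ≡⟨ ∑-+ J D _ ⟩
    ∑ J D + ∑ J (λ y → D (y ⊕ j))                   ≡⟨ cong (∑ J D +_) (∑-⊕ J D j) ⟩
    ∑ J D + ∑ J D                                   ≡⟨ cong (∑ J D +_) (ℕ.+-identityʳ (∑ J D)) ⟨
    2 ℕ.* ∑ J D ∎
    where
    open ℕ.≤-Reasoning
    D : Cube J → ℕ
    D y = differ selected g (x ++ y)
    value : ∀ y → selected (x ++ y) ≡ not (lookup y j)
    value y = trans (selected-++ x y) (cong (λ s → answer s y) sel)
    flipped : ∀ y → selected (x ++ (y ⊕ j)) ≡ not (not (lookup y j))
    flipped y = trans (value (y ⊕ j)) (cong not (Vec.lookup∘updateAt j y))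
    violated : ∀ y → 1 ≤ℕ D y + D (y ⊕ j)
    violated y with lookup y j in e | value y | flipped y
    ... | false | ft | ff = violated-edge selected g (x ++ y) (x ++ (y ⊕ j)) ft ff
                              (mono _ _ (++-≼ x (≼-⊕ y j e)))
    ... | true  | ff | ft = ℕ.≤-trans
      (violated-edge selected g (x ++ (y ⊕ j)) (x ++ y) ft ff (mono _ _ (++-≼ x (⊕-≼ y j e))))
      (ℕ.≤-reflexive (ℕ.+-comm (D (y ⊕ j)) (D y)))

  -- Sum `fibre-distance` over `x`: a proportion of at least 1/u of the fibres sits at a level, and
  -- `g` errs on at least half of each of those.
  #distance : ∀ g → Monotone g →
              2 ^ (v + J) ≤ℕ u ℕ.* 2 ℕ.* # (λ z → ¬? (selected z Bool.≟ g z))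
  #distance g mono = begin
    2 ^ (v + J)                                          ≡⟨ ℕ.^-distribˡ-+-* 2 v J ⟩
    2 ^ v ℕ.* 2 ^ J                                      ≤⟨ ℕ.*-monoˡ-≤ (2 ^ J) (frequent S) ⟩
    u ℕ.* ∑ v (isMid ∘ select S) ℕ.* 2 ^ J               ≡⟨ ℕ.*-assoc u _ _ ⟩
    u ℕ.* (∑ v (isMid ∘ select S) ℕ.* 2 ^ J)             ≡⟨ cong (u ℕ.*_) (∑-*ʳ v (isMid ∘ select S) (2 ^ J)) ⟨
    u ℕ.* ∑ v (λ x → isMid (select S x) ℕ.* 2 ^ J)
      ≤⟨ ℕ.*-monoʳ-≤ u (∑-mono v λ x → ℕ.≤-trans
           (ℕ.≤-reflexive (ℕ.*-comm (isMid (select S x)) (2 ^ J)))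
           (ℕ.≤-trans (fibre-distance g mono x) (ℕ.≤-reflexive (ℕ.*-comm 2 (∑ J (λ y → D (x ++ y))))))) ⟩
    u ℕ.* ∑ v (λ x → ∑ J (λ y → D (x ++ y)) ℕ.* 2)       ≡⟨ cong (u ℕ.*_) (∑-*ʳ v _ 2) ⟩
    u ℕ.* (∑ v (λ x → ∑ J (λ y → D (x ++ y))) ℕ.* 2)     ≡⟨ cong (λ c → u ℕ.* (c ℕ.* 2)) (∑-++ v D) ⟨
    u ℕ.* (∑ (v + J) D ℕ.* 2)                            ≡⟨ cong (λ c → u ℕ.* (c ℕ.* 2)) (#≡∑ (v + J) _) ⟨
    u ℕ.* (#D ℕ.* 2)                                     ≡⟨ cong (u ℕ.*_) (ℕ.*-comm #D 2) ⟩
    u ℕ.* (2 ℕ.* #D)                                     ≡⟨ ℕ.*-assoc u 2 #D ⟨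
    u ℕ.* 2 ℕ.* #D                                       ∎
    where
    open ℕ.≤-Reasoning
    D = differ selected g
    #D = # (λ z → ¬? (selected z Bool.≟ g z))

-- Choice of parameters

-- This is 2(a + 2) ≤ 2^a for a = 4 + d. It fails at a = 3, so half of `k` has to be at least 4;
-- hence the hypothesis `8 ≤ k` below.
linear≤2^ : ∀ d → 2 ℕ.* (6 + d) ≤ℕ 2 ^ (4 + d)
linear≤2^ zero    = ℕ.m≤m+n 12 4
linear≤2^ (suc d) = begin
  2 ℕ.* (7 + d)               ≤⟨ ℕ.*-monoʳ-≤ 2 (ℕ.≤-trans (ℕ.m≤m+n (7 + d) (5 + d)) (ℕ.≤-reflexive (double d))) ⟩
  2 ℕ.* (2 ℕ.* (6 + d))       ≤⟨ ℕ.*-monoʳ-≤ 2 (linear≤2^ d) ⟩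
  2 ^ (5 + d)                 ∎
  where
  open ℕ.≤-Reasoning
  double : ∀ d → (7 + d) + (5 + d) ≡ 2 ℕ.* (6 + d)
  double = solve-∀

-- The index sets of the two factors multiply to exactly 2 ^ k, while their
-- variables number only about 2 ^ (k / 2) * k.
selector : ∀ k → 8 ≤ℕ k → Selector (2 ^ k) (2 ^ k) (4 ℕ.* 2 ^ k) 16
selector k 8≤k = pad variables≤ (subst₂ (λ J p → Selector (2 ^ a ℕ.* suc a + 2 ^ b ℕ.* suc b) J p 16) indices rarity
  (lexSelector (tribesSelector (suc a) (2 ^ a) {{ℕ.m^n≢0 2 a}} refl)
               (tribesSelector (suc b) (2 ^ b) {{ℕ.m^n≢0 2 b}} refl)))
  where
  open ℕ.≤-Reasoning
  a = ℕ.⌊ k /2⌋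
  b = ℕ.⌈ k /2⌉
  indices : 2 ^ a ℕ.* 2 ^ b ≡ 2 ^ k
  indices = trans (sym (ℕ.^-distribˡ-+-* 2 a b)) (cong (2 ^_) (ℕ.⌊n/2⌋+⌈n/2⌉≡n k))
  rarity : 2 ^ suc a ℕ.* 2 ^ suc b ≡ 4 ℕ.* 2 ^ k
  rarity = trans (regroup (2 ^ a) (2 ^ b)) (cong (4 ℕ.*_) indices)
    where
    regroup : ∀ x y → (2 ℕ.* x) ℕ.* (2 ℕ.* y) ≡ 4 ℕ.* (x ℕ.* y)
    regroup = solve-∀
  small : 2 ℕ.* (2 + a) ≤ℕ 2 ^ a
  -- Since `b` is `a` or `a + 1`, this one inequality gives both 2(a + 1) ≤ 2^b and 2(b + 1) ≤ 2^a,
  -- so that each tribes factor takes at most half of the `2 ^ k` variables.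
  small with d , e ← ℕ.m≤n⇒∃[o]m+o≡n (ℕ.⌊n/2⌋-mono 8≤k) =
    subst (λ a → 2 ℕ.* (2 + a) ≤ℕ 2 ^ a) e (linear≤2^ d)
  variables≤ : 2 ^ a ℕ.* suc a + 2 ^ b ℕ.* suc b ≤ℕ 2 ^ k
  variables≤ = ℕ.*-cancelˡ-≤ 2 (begin
    2 ℕ.* (2 ^ a ℕ.* suc a + 2 ^ b ℕ.* suc b)             ≡⟨ distrib (2 ^ a) a (2 ^ b) b ⟩
    2 ^ a ℕ.* (2 ℕ.* suc a) + 2 ^ b ℕ.* (2 ℕ.* suc b)
      ≤⟨ ℕ.+-mono-≤
           (ℕ.*-monoʳ-≤ (2 ^ a) (ℕ.≤-trans (ℕ.*-monoʳ-≤ 2 (ℕ.n≤1+n (suc a)))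
             (ℕ.≤-trans small (ℕ.^-monoʳ-≤ 2 (ℕ.⌊n/2⌋≤⌈n/2⌉ k)))))
           (ℕ.*-monoʳ-≤ (2 ^ b) (ℕ.≤-trans (ℕ.*-monoʳ-≤ 2 (s≤s (ℕ.⌊n/2⌋-mono (ℕ.n≤1+n (suc k))))) small)) ⟩
    2 ^ a ℕ.* 2 ^ b + 2 ^ b ℕ.* 2 ^ a                     ≡⟨ collect (2 ^ a) (2 ^ b) ⟩
    2 ℕ.* (2 ^ a ℕ.* 2 ^ b)                               ≡⟨ cong (2 ℕ.*_) indices ⟩
    2 ℕ.* 2 ^ k                                           ∎)
    where
    distrib : ∀ x a y b → 2 ℕ.* (x ℕ.* (1 + a) + y ℕ.* (1 + b)) ≡ x ℕ.* (2 ℕ.* (1 + a)) + y ℕ.* (2 ℕ.* (1 + b))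
    distrib = solve-∀
    collect : ∀ x y → x ℕ.* y + y ℕ.* x ≡ 2 ℕ.* (x ℕ.* y)
    collect = solve-∀

-- Fractions

/-mono-≤ : ∀ a b c d .{{_ : NonZero b}} .{{_ : NonZero d}} →
           a ℕ.* d ≤ℕ c ℕ.* b → (ℤ.+ a) / b ≤ (ℤ.+ c) / d
/-mono-≤ a b@(suc b-1) c d@(suc d-1) ad≤cb = ℚ.toℚᵘ-cancel-≤
  (ℚᵘ.≤-respˡ-≃ (ℚᵘ.≃-sym (ℚ.toℚᵘ-fromℚᵘ (mkℚᵘ (ℤ.+ a) b-1)))
    (ℚᵘ.≤-respʳ-≃ (ℚᵘ.≃-sym (ℚ.toℚᵘ-fromℚᵘ (mkℚᵘ (ℤ.+ c) d-1)))
      (ℚᵘ.*≤* (subst₂ ℤ._≤_ (ℤ.pos-* a d) (ℤ.pos-* c b) (ℤ.+≤+ ad≤cb)))))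

/-cancel-≤ : ∀ a b c d .{{_ : NonZero b}} .{{_ : NonZero d}} →
             (ℤ.+ a) / b ≤ (ℤ.+ c) / d → a ℕ.* d ≤ℕ c ℕ.* b
/-cancel-≤ a b@(suc b-1) c d@(suc d-1) a/b≤c/d = ℤ.drop‿+≤+
  (subst₂ ℤ._≤_ (sym (ℤ.pos-* a d)) (sym (ℤ.pos-* c b)) (ℚᵘ.drop-*≤*
    (ℚᵘ.≤-respˡ-≃ (ℚ.toℚᵘ-fromℚᵘ (mkℚᵘ (ℤ.+ a) b-1))
      (ℚᵘ.≤-respʳ-≃ (ℚ.toℚᵘ-fromℚᵘ (mkℚᵘ (ℤ.+ c) d-1)) (ℚ.toℚᵘ-mono-≤ a/b≤c/d)))))

/-* : ∀ a b c d .{{_ : NonZero b}} .{{_ : NonZero d}} .{{_ : NonZero (b ℕ.* d)}} →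
      (ℤ.+ a) / b * ((ℤ.+ c) / d) ≡ (ℤ.+ (a ℕ.* c)) / (b ℕ.* d)
/-* a b@(suc b-1) c d@(suc d-1) = trans (ℚ.toℚᵘ-injective (begin
  toℚᵘ ((ℤ.+ a) / b * ((ℤ.+ c) / d))                         ≈⟨ ℚ.toℚᵘ-homo-* ((ℤ.+ a) / b) ((ℤ.+ c) / d) ⟩
  toℚᵘ ((ℤ.+ a) / b) ℚᵘ.* toℚᵘ ((ℤ.+ c) / d)
    ≈⟨ ℚᵘ.*-cong (ℚ.toℚᵘ-fromℚᵘ (mkℚᵘ (ℤ.+ a) b-1)) (ℚ.toℚᵘ-fromℚᵘ (mkℚᵘ (ℤ.+ c) d-1)) ⟩
  mkℚᵘ (ℤ.+ a) b-1 ℚᵘ.* mkℚᵘ (ℤ.+ c) d-1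
    ≈⟨ ℚ.toℚᵘ-fromℚᵘ (mkℚᵘ (ℤ.+ a) b-1 ℚᵘ.* mkℚᵘ (ℤ.+ c) d-1) ⟨
  toℚᵘ ((ℤ.+ a ℤ.* ℤ.+ c) / (b ℕ.* d)) ∎)) (ℚ./-cong (sym (ℤ.pos-* a c)) refl)
  where open ℚᵘ.≃-Reasoning

-- Shaped after the left side of the logarithmic bound: the constant and the distance are replaced
-- by lower bounds, while 1/m and the approximation of the logarithm stay fixed.
*⁴-mono-≤ : ∀ a a′ b b′ c d → a ≤ a′ → b ≤ b′ →
  ℚ.NonNegative a → ℚ.NonNegative b′ → ℚ.NonNegative c → ℚ.NonNegative d →
  a * b * c * d ≤ a′ * b′ * c * d
*⁴-mono-≤ a a′ b b′ c d a≤a′ b≤b′ 0≤a 0≤b′ 0≤c 0≤d =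
  ℚ.*-monoʳ-≤-nonNeg d {{0≤d}} (ℚ.*-monoʳ-≤-nonNeg c {{0≤c}}
    (ℚ.≤-trans (ℚ.*-monoˡ-≤-nonNeg a {{0≤a}} b≤b′) (ℚ.*-monoʳ-≤-nonNeg b′ {{0≤b′}} a≤a′)))

-- The denominator of `q` serves, because the numerator is at least 1.
positive⇒1/≤ : ∀ q → 0ℚ < q → Σ[ b ∈ ℕ ] (1ℤ / suc b ≤ q)
positive⇒1/≤ q@(mkℚ +[1+ a ] d-1 _) 0<q = d-1 ,
  subst (1ℤ / suc d-1 ≤_) (ℚ.fromℚᵘ-toℚᵘ q)
    (/-mono-≤ 1 (suc d-1) (suc a) (suc d-1) (ℕ.*-monoˡ-≤ (suc d-1) {1} {suc a} (s≤s z≤n)))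
positive⇒1/≤ (mkℚ (ℤ.+ 0)    _ _) (ℚ.*<* (ℤ.+<+ ()))
positive⇒1/≤ (mkℚ -[1+ _ ] _ _) (ℚ.*<* ())

-- The hard functions

HardFunction : (n : ℕ) .{{_ : NonZero n}} → Set
HardFunction n = Σ[ f ∈ BoolFun (n + n) ]
  (∀ (i : Fin n) → Inf⁻ (i ↑ˡ n) f ≡ 0ℚ) ×
  (∀ (i : Fin n) → Inf⁻ (n ↑ʳ i) f ≤ 1ℚ * (1ℤ / n)) ×
  1ℤ / 32 ≤ ε f

0/2^ : ∀ m → 0 /2^ m ≡ 0ℚ
0/2^ m = ℚ.≤-antisym (/-mono-≤ 0 (2 ^ m) 0 1 {{ℕ.m^n≢0 2 m}} z≤n)
                     (/-mono-≤ 0 1 0 (2 ^ m) {{_}} {{ℕ.m^n≢0 2 m}} z≤n)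

2^-pred-+ : ∀ n .{{_ : NonZero n}} → 2 ^ (n + n) ≡ 2 ℕ.* 2 ^ (n + n ℕ.∸ 1)
2^-pred-+ (suc n) = refl

hardFunction : ∀ k → 8 ≤ℕ k → .{{_ : NonZero (2 ^ k)}} → HardFunction (2 ^ k)
hardFunction k 8≤k = f , inf-↑ˡ , inf-↑ʳ , far
  where
  N = 2 ^ k
  S = selector k 8≤k
  f = selected S
  inf-↑ˡ : ∀ i → Inf⁻ (i ↑ˡ N) f ≡ 0ℚ
  inf-↑ˡ i = trans (cong (_/2^ (N + N ℕ.∸ 1)) (#negEdge-↑ˡ S i)) (0/2^ (N + N ℕ.∸ 1))
  inf-↑ʳ : ∀ i → Inf⁻ (N ↑ʳ i) f ≤ 1ℚ * (1ℤ / N)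
  -- Rarity `4 ℕ.* N` in fact bounds the influence by 1/(2N); the spare factor 2 is given away.
  inf-↑ʳ i = subst (Inf⁻ (N ↑ʳ i) f ≤_) (sym (ℚ.*-identityˡ (1ℤ / N)))
    (/-mono-≤ #i (2 ^ (N + N ℕ.∸ 1)) 1 N {{ℕ.m^n≢0 2 (N + N ℕ.∸ 1)}} (ℕ.*-cancelˡ-≤ 2 (begin
      2 ℕ.* (#i ℕ.* N)                     ≤⟨ ℕ.m≤m+n _ (2 ℕ.* (#i ℕ.* N)) ⟩
      2 ℕ.* (#i ℕ.* N) + 2 ℕ.* (#i ℕ.* N)  ≡⟨ collect #i N ⟩
      #i ℕ.* (4 ℕ.* N)                     ≤⟨ #negEdge-↑ʳ S i ⟩
      2 ^ (N + N)                          ≡⟨ 2^-pred-+ N ⟩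
      2 ℕ.* 2 ^ (N + N ℕ.∸ 1)              ≡⟨ cong (2 ℕ.*_) (ℕ.*-identityˡ (2 ^ (N + N ℕ.∸ 1))) ⟨
      2 ℕ.* (1 ℕ.* 2 ^ (N + N ℕ.∸ 1))      ∎)))
    where
    open ℕ.≤-Reasoning
    #i = # (negEdge? f (N ↑ʳ i))
    collect : ∀ a N → 2 ℕ.* (a ℕ.* N) + 2 ℕ.* (a ℕ.* N) ≡ a ℕ.* (4 ℕ.* N)
    collect = solve-∀
  far : 1ℤ / 32 ≤ ε f
  far = /-mono-≤ 1 32 #D (2 ^ (N + N)) {{_}} {{ℕ.m^n≢0 2 (N + N)}} (begin
    1 ℕ.* 2 ^ (N + N)  ≡⟨ ℕ.*-identityˡ _ ⟩
    2 ^ (N + N)        ≤⟨ #distance S g (nearestMonotone-monotone f) ⟩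
    32 ℕ.* #D          ≡⟨ ℕ.*-comm 32 #D ⟩
    #D ℕ.* 32          ∎)
    where
    open ℕ.≤-Reasoning
    g = nearestMonotone f
    #D = # (λ z → ¬? (f z Bool.≟ g z))

256≤2^⇒8≤ : ∀ k → 256 ≤ℕ 2 ^ k → 8 ≤ℕ k
256≤2^⇒8≤ k 256≤ = ℕ.≮⇒≥ λ k<8 → ℕ.<⇒≱ (ℕ.^-monoʳ-< 2 (s≤s (s≤s z≤n)) k<8) 256≤

-- Refutation of the logarithmic bound

LogBound : ℚ → Set
LogBound c′ = ∀ (m : ℕ) .{{_ : NonZero m}} (f : BoolFun m) →
  Σ[ i ∈ Fin m ] (c′ * ε f * (1ℤ / m)) ·log₂ m ≤ Inf⁻ i f

-- The coordinate supplied by the bound yields l / (b e 2n) ≤ 1/n, where `l` is at most the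
-- logarithm of the dimension 2n; clearing denominators limits `l` by a constant.
logBound⇒≤ : ∀ {c′} b e n l .{{_ : NonZero b}} .{{_ : NonZero e}} .{{_ : NonZero n}}
  (f : BoolFun (n + n)) → (∀ i → Inf⁻ i f ≤ 1ℤ / n) → 1ℤ / b ≤ c′ → 1ℤ / e ≤ ε f →
  2 ^ l ≤ℕ n + n → LogBound c′ → l ≤ℕ b ℕ.* e ℕ.* 2
logBound⇒≤ {c′} b e n l f inf≤ 1/b≤c′ 1/e≤ε 2^l≤ bound = ℕ.*-cancelʳ-≤ l (b ℕ.* e ℕ.* 2) n (begin
  l ℕ.* n                             ≤⟨ /-cancel-≤ l (b ℕ.* e ℕ.* (n + n) ℕ.* 1) 1 n l/≤1/n ⟩
  1 ℕ.* (b ℕ.* e ℕ.* (n + n) ℕ.* 1)   ≡⟨ regroup b e n ⟩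
  b ℕ.* e ℕ.* 2 ℕ.* n                 ∎)
  where
  open ℕ.≤-Reasoning
  regroup : ∀ b e n → 1 ℕ.* (b ℕ.* e ℕ.* (n + n) ℕ.* 1) ≡ b ℕ.* e ℕ.* 2 ℕ.* n
  regroup = solve-∀
  instance
    n+n≢0 : NonZero (n + n)
    n+n≢0 = ℕ.>-nonZero (ℕ.≤-trans (ℕ.>-nonZero⁻¹ n) (ℕ.m≤m+n n n))
    be≢0 : NonZero (b ℕ.* e)
    be≢0 = ℕ.m*n≢0 b e
    be[n+n]≢0 : NonZero (b ℕ.* e ℕ.* (n + n))
    be[n+n]≢0 = ℕ.m*n≢0 (b ℕ.* e) (n + n)
    be[n+n]1≢0 : NonZero (b ℕ.* e ℕ.* (n + n) ℕ.* 1)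
    be[n+n]1≢0 = ℕ.m*n≢0 (b ℕ.* e ℕ.* (n + n)) 1
  1/[n+n] : ℚ
  1/[n+n] = 1ℤ / (n + n)
  l/1 : ℚ
  l/1 = (ℤ.+ l) / 1
  0≤ε : 0ℚ ≤ ε f
  0≤ε = ℚ.≤-trans (/-mono-≤ 0 1 1 e z≤n) 1/e≤ε
  product≤ : 1ℤ / b * (1ℤ / e) * 1/[n+n] * l/1 ≤ c′ * ε f * 1/[n+n] * l/1
  product≤ = *⁴-mono-≤ (1ℤ / b) c′ (1ℤ / e) (ε f) 1/[n+n] l/1 1/b≤c′ 1/e≤ε
    (ℚ.normalize-nonNeg 1 b) (ℚ.nonNegative 0≤ε) (ℚ.normalize-nonNeg 1 (n + n)) (ℚ.normalize-nonNeg l 1)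
  fraction : 1ℤ / b * (1ℤ / e) * 1/[n+n] * l/1 ≡ (ℤ.+ l) / (b ℕ.* e ℕ.* (n + n) ℕ.* 1)
  fraction = trans
    (cong (_* l/1) (trans (cong (_* 1/[n+n]) (/-* 1 b 1 e)) (/-* 1 (b ℕ.* e) 1 (n + n))))
    (trans (/-* 1 (b ℕ.* e ℕ.* (n + n)) l 1)
           (ℚ./-cong (cong ℤ.+_ (ℕ.*-identityˡ l)) refl))
  l/≤1/n : (ℤ.+ l) / (b ℕ.* e ℕ.* (n + n) ℕ.* 1) ≤ 1ℤ / n
  l/≤1/n = subst (_≤ 1ℤ / n) fraction
    (ℚ.≤-trans product≤ (ℚ.≤-trans
      -- The rational `l / 1` is the approximation from below of the logarithm of `n + n`.
      (proj₂ (bound (n + n) f) l 1 (ℕ.≤-trans 2^l≤ (ℕ.≤-reflexive (sym (ℕ.*-identityʳ (n + n))))))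
      (inf≤ (proj₁ (bound (n + n) f)))))

inf≤ : ∀ n .{{_ : NonZero n}} ((f , _) : HardFunction n) i → Inf⁻ i f ≤ 1ℤ / n
inf≤ n (f , inf-↑ˡ , inf-↑ʳ , _) i = at (splitAt n i) refl
  where
  at : ∀ s → splitAt n i ≡ s → Inf⁻ i f ≤ 1ℤ / n
  at (inj₁ j) e = subst (λ i → Inf⁻ i f ≤ 1ℤ / n) (Fin.splitAt⁻¹-↑ˡ e)
    (subst (_≤ 1ℤ / n) (sym (inf-↑ˡ j)) (/-mono-≤ 0 1 1 n z≤n))
  at (inj₂ j) e = subst (λ i → Inf⁻ i f ≤ 1ℤ / n) (Fin.splitAt⁻¹-↑ʳ e)
    (subst (Inf⁻ (n ↑ʳ j) f ≤_) (ℚ.*-identityˡ (1ℤ / n)) (inf-↑ʳ j))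

hardFunction⇒≤ : ∀ {c′} b k .{{_ : NonZero b}} → 1ℤ / b ≤ c′ → LogBound c′ → 8 ≤ℕ k →
                 suc k ≤ℕ b ℕ.* 32 ℕ.* 2
hardFunction⇒≤ b k 1/b≤c′ bound 8≤k =
  -- The dimension is twice `2 ^ k`, so its logarithm is exactly `suc k`.
  logBound⇒≤ b 32 (2 ^ k) (suc k) (proj₁ hard) (inf≤ (2 ^ k) hard) 1/b≤c′
    (proj₂ (proj₂ (proj₂ hard)))
    (ℕ.≤-reflexive (cong (2 ^ k +_) (ℕ.+-identityʳ (2 ^ k)))) bound
  where
  instance
    2^k≢0 : NonZero (2 ^ k)
    2^k≢0 = ℕ.m^n≢0 2 k
  hard : HardFunction (2 ^ k)
  hard = hardFunction k 8≤k

¬logBound : ∀ {c′} b .{{_ : NonZero b}} → 1ℤ / b ≤ c′ → ¬ LogBound c′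
-- Taking `k` equal to the upper bound `b ℕ.* 32 ℕ.* 2` itself gives `suc k` at most `k`; this `k`
-- is at least 64 and so large enough.
¬logBound b 1/b≤c′ bound = ℕ.<-irrefl refl (hardFunction⇒≤ b (b ℕ.* 32 ℕ.* 2) 1/b≤c′ bound
  (ℕ.≤-trans (ℕ.m≤m+n 8 56) (ℕ.*-monoˡ-≤ 2 (ℕ.*-monoˡ-≤ 32 (ℕ.>-nonZero⁻¹ b)))))

mainTheorem1 : (Σ[ C ∈ ℚ ] Σ[ c ∈ ℚ ] Σ[ n₀ ∈ ℕ ] 0ℚ < C × 0ℚ < c ×
    (∀ (n : ℕ) .{{_ : NonZero n}} → n₀ ≤ℕ n → (∃[ k ] n ≡ 2 ^ k) →
    Σ[ f ∈ BoolFun (n + n) ]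
    (∀ (i : Fin n) → Inf⁻ (i ↑ˡ n) f ≡ 0ℚ) ×
    (∀ (i : Fin n) → Inf⁻ (n ↑ʳ i) f ≤ C * (1ℤ / n)) ×
    c ≤ ε f))
    ×
    ¬ (Σ[ c′ ∈ ℚ ] 0ℚ < c′ ×
    (∀ (m : ℕ) .{{_ : NonZero m}} (f : BoolFun m) →
    Σ[ i ∈ Fin m ] (c′ * ε f * (1ℤ / m)) ·log₂ m ≤ Inf⁻ i f))
mainTheorem1 =
  -- The denominator 32 is twice the 16 of `selector`, and 256 is 2^8, matching `8 ≤ k`.
  ( 1ℚ , 1ℤ / 32 , 256 , ℚ.positive⁻¹ 1ℚ , ℚ.positive⁻¹ (1ℤ / 32)
  , λ { n 256≤n (k , refl) → hardFunction k (256≤2^⇒8≤ k 256≤n) }) ,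
  λ { (c′ , 0<c′ , bound) →
        let b-1 , 1/b≤c′ = positive⇒1/≤ c′ 0<c′ in ¬logBound (suc b-1) 1/b≤c′ bound }
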